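{- The rule $\mathsf{EM}_1^-$ is equivalent over $\mathsf{HA}$ to Markov's principle: (i) for every atomic formula $\mathsf P$, the formula $\neg\forall\alpha\,\mathsf P\to\exists\alpha\,\mathsf P^\perp$ is derivable in $\mathsf{HA}+\mathsf{EM}_1^-$; (ii) in $\mathsf{HA}$ extended with all instances of the axiom $\textsc{mrk}$: $\neg\forall\alpha\,\mathsf Q\to\exists\alpha\,\mathsf Q^\perp$ ($\mathsf Q$ atomic), the rule $\mathsf{EM}_1^-$ is derivable, i.e. whenever $\Gamma,\forall\alpha\mathsf P\vdash\exists\alpha C$ and $\Gamma,\exists\alpha\mathsf P^\perp\vdash\exists\alpha C$ are derivable with $\mathsf P, C$ atomic, then $\Gamma\vdash\exists\alpha C$ is derivable.
   Context: $\mathsf{HA}$ is intuitionistic (Heyting) arithmetic in natural deduction, with decidable atomic formulas; for atomic $\mathsf P$, $\mathsf P^\perp$ is its atomic complement (provably equivalent to $\neg\mathsf P$), and $\neg A:=A\to\bot$. The rule $\mathsf{EM}_1^-$: for atomic $\mathsf P$ and atomic $C$, from derivations of $\Gamma,\forall\alpha\mathsf P\vdash\exists xC$ and $\Gamma,\exists\alpha\mathsf P^\perp\vdash\exists xC$, discharging the two assumptions, infer $\Gamma\vdash\exists xC$. $\mathsf{HA}+\mathsf{EM}_1^-$ is $\mathsf{HA}$ with this rule added. -}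

module Defs where

open import Data.Nat using (ℕ; zero; suc)
open import Data.Fin using (Fin; zero; suc)
open import Data.Vec using (Vec; []; _∷_; lookup)
open import Data.Bool using (Bool; true; false; not)
open import Data.List using (List; []; _∷_; map)
open import Data.List.Membership.Propositional using (_∈_)
open import Data.List.Relation.Unary.All using (All)
open import Data.Empty using (⊥)
open import Relation.Binary.PropositionalEquality using (_≡_; _≢_)

data PR : ℕ → Set where
  Z    : PR 0
  S    : PR 1
  π    : ∀ {n} → Fin n → PR n
  comp : ∀ {k n} → PR k → Vec (PR n) k → PR n
  rec  : ∀ {n} → PR n → PR (suc (suc n)) → PR (suc n)

mutual
  evalPR : ∀ {n} → PR n → Vec ℕ n → ℕ
  evalPR Z [] = 0
  evalPR S (x ∷ []) = suc x
  evalPR (π i) xs = lookup xs i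
  evalPR (comp f gs) xs = evalPR f (evalPRs gs xs)
  evalPR (rec g h) (zero ∷ xs) = evalPR g xs
  evalPR (rec g h) (suc x ∷ xs) = evalPR h (evalPR (rec g h) (x ∷ xs) ∷ x ∷ xs)

  evalPRs : ∀ {k n} → Vec (PR n) k → Vec ℕ n → Vec ℕ k
  evalPRs [] xs = []
  evalPRs (g ∷ gs) xs = evalPR g xs ∷ evalPRs gs xs

data Term (n : ℕ) : Set where
  var : Fin n → Term n
  app : ∀ {k} → PR k → Vec (Term n) k → Term n

zeroT : ∀ {n} → Term n
zeroT = app Z []

sucT : ∀ {n} → Term n → Term n
sucT t = app S (t ∷ [])

mutual
  evalT : ∀ {n} → Term n → (Fin n → ℕ) → ℕ
  evalT (var i) ρ = ρ i
  evalT (app f ts) ρ = evalPR f (evalTs ts ρ)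

  evalTs : ∀ {n k} → Vec (Term n) k → (Fin n → ℕ) → Vec ℕ k
  evalTs [] ρ = []
  evalTs (t ∷ ts) ρ = evalT t ρ ∷ evalTs ts ρ

mutual
  renT : ∀ {n m} → (Fin n → Fin m) → Term n → Term m
  renT r (var i) = var (r i)
  renT r (app f ts) = app f (renTs r ts)

  renTs : ∀ {n m k} → (Fin n → Fin m) → Vec (Term n) k → Vec (Term m) k
  renTs r [] = []
  renTs r (t ∷ ts) = renT r t ∷ renTs r ts

mutual
  subT : ∀ {n m} → (Fin n → Term m) → Term n → Term m
  subT σ (var i) = σ i
  subT σ (app f ts) = app f (subTs σ ts)

  subTs : ∀ {n m k} → (Fin n → Term m) → Vec (Term n) k → Vec (Term m) k
  subTs σ [] = []
  subTs σ (t ∷ ts) = subT σ t ∷ subTs σ ts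

liftσ : ∀ {n m} → (Fin n → Term m) → Fin (suc n) → Term (suc m)
liftσ σ zero = var zero
liftσ σ (suc i) = renT suc (σ i)

-- The symbol  rel true f  denotes the predicate  f(x⃗) = 0,
-- the symbol  rel false f  denotes its complement  f(x⃗) ≠ 0.

data Atom (n : ℕ) : Set where
  rel : ∀ {k} → Bool → PR k → Vec (Term n) k → Atom n

_ᶜ : ∀ {n} → Atom n → Atom n
rel b f ts ᶜ = rel (not b) f ts

⟦_⟧ₐ : ∀ {n} → Atom n → (Fin n → ℕ) → Set
⟦ rel true  f ts ⟧ₐ ρ = evalPR f (evalTs ts ρ) ≡ 0
⟦ rel false f ts ⟧ₐ ρ = evalPR f (evalTs ts ρ) ≢ 0

subA : ∀ {n m} → (Fin n → Term m) → Atom n → Atom m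
subA σ (rel b f ts) = rel b f (subTs σ ts)

infixr 6 _∧'_
infixr 5 _∨'_
infixr 4 _⇒_

data Formula (n : ℕ) : Set where
  atom  : Atom n → Formula n
  ⊥'    : Formula n
  _∧'_  : Formula n → Formula n → Formula n
  _∨'_  : Formula n → Formula n → Formula n
  _⇒_   : Formula n → Formula n → Formula n
  ∀'    : Formula (suc n) → Formula n
  ∃'    : Formula (suc n) → Formula n

¬' : ∀ {n} → Formula n → Formula n
¬' A = A ⇒ ⊥'

subF : ∀ {n m} → (Fin n → Term m) → Formula n → Formula m
subF σ (atom a) = atom (subA σ a)
subF σ ⊥' = ⊥'
subF σ (A ∧' B) = subF σ A ∧' subF σ B
subF σ (A ∨' B) = subF σ A ∨' subF σ B
subF σ (A ⇒ B) = subF σ A ⇒ subF σ B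
subF σ (∀' A) = ∀' (subF (liftσ σ) A)
subF σ (∃' A) = ∃' (subF (liftσ σ) A)

wkF : ∀ {n} → Formula n → Formula (suc n)
wkF = subF (λ i → var (suc i))

-- A[t/α] where α is the variable bound by the outermost quantifier (index 0)
_[_] : ∀ {n} → Formula (suc n) → Term n → Formula n
A [ t ] = subF σ A
  where
  σ : _ → _
  σ zero = t
  σ (suc i) = var i

stepF : ∀ {n} → Formula (suc n) → Formula (suc n)
stepF A = subF σ A
  where
  σ : _ → _
  σ zero = sucT (var zero)
  σ (suc i) = var (suc i)

data Sys : Set where
  HA HA+EM1⁻ HA+MRK : Sys

infix 2 _⊢[_]_

data _⊢[_]_ : ∀ {n} → List (Formula n) → Sys → Formula n → Set where
  ax   : ∀ {n Γ s} {A : Formula n} → A ∈ Γ → Γ ⊢[ s ] A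
  ⊥E   : ∀ {n Γ s} {A : Formula n} → Γ ⊢[ s ] ⊥' → Γ ⊢[ s ] A
  ⇒I   : ∀ {n Γ s} {A B : Formula n} → (A ∷ Γ) ⊢[ s ] B → Γ ⊢[ s ] A ⇒ B
  ⇒E   : ∀ {n Γ s} {A B : Formula n} → Γ ⊢[ s ] A ⇒ B → Γ ⊢[ s ] A → Γ ⊢[ s ] B
  ∧I   : ∀ {n Γ s} {A B : Formula n} → Γ ⊢[ s ] A → Γ ⊢[ s ] B → Γ ⊢[ s ] A ∧' B
  ∧E₁  : ∀ {n Γ s} {A B : Formula n} → Γ ⊢[ s ] A ∧' B → Γ ⊢[ s ] A
  ∧E₂  : ∀ {n Γ s} {A B : Formula n} → Γ ⊢[ s ] A ∧' B → Γ ⊢[ s ] B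
  ∨I₁  : ∀ {n Γ s} {A B : Formula n} → Γ ⊢[ s ] A → Γ ⊢[ s ] A ∨' B
  ∨I₂  : ∀ {n Γ s} {A B : Formula n} → Γ ⊢[ s ] B → Γ ⊢[ s ] A ∨' B
  ∨E   : ∀ {n Γ s} {A B C : Formula n} → Γ ⊢[ s ] A ∨' B →
         (A ∷ Γ) ⊢[ s ] C → (B ∷ Γ) ⊢[ s ] C → Γ ⊢[ s ] C
  ∀I   : ∀ {n Γ s} {A : Formula (suc n)} → map wkF Γ ⊢[ s ] A → Γ ⊢[ s ] ∀' A
  ∀E   : ∀ {n Γ s} {A : Formula (suc n)} → Γ ⊢[ s ] ∀' A → (t : Term n) → Γ ⊢[ s ] A [ t ]
  ∃I   : ∀ {n Γ s} {A : Formula (suc n)} (t : Term n) → Γ ⊢[ s ] A [ t ] → Γ ⊢[ s ] ∃' A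
  ∃E   : ∀ {n Γ s} {A : Formula (suc n)} {C : Formula n} → Γ ⊢[ s ] ∃' A →
         (A ∷ map wkF Γ) ⊢[ s ] wkF C → Γ ⊢[ s ] C
  ind  : ∀ {n Γ s} {A : Formula (suc n)} → Γ ⊢[ s ] A [ zeroT ] →
         (A ∷ map wkF Γ) ⊢[ s ] stepF A → Γ ⊢[ s ] ∀' A
  post : ∀ {n Γ s} (As : List (Atom n)) (B : Atom n) →
         (∀ (ρ : Fin n → ℕ) → All (λ a → ⟦ a ⟧ₐ ρ) As → ⟦ B ⟧ₐ ρ) →
         All (λ a → Γ ⊢[ s ] atom a) As → Γ ⊢[ s ] atom B
  post⊥ : ∀ {n Γ s} (As : List (Atom n)) →
         (∀ (ρ : Fin n → ℕ) → All (λ a → ⟦ a ⟧ₐ ρ) As → ⊥) →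
         All (λ a → Γ ⊢[ s ] atom a) As → Γ ⊢[ s ] ⊥'
  em1⁻ : ∀ {n Γ} (P C : Atom (suc n)) →
         (∀' (atom P) ∷ Γ) ⊢[ HA+EM1⁻ ] ∃' (atom C) →
         (∃' (atom (P ᶜ)) ∷ Γ) ⊢[ HA+EM1⁻ ] ∃' (atom C) →
         Γ ⊢[ HA+EM1⁻ ] ∃' (atom C)
  mrk  : ∀ {n Γ} (Q : Atom (suc n)) →
         Γ ⊢[ HA+MRK ] ¬' (∀' (atom Q)) ⇒ ∃' (atom (Q ᶜ))

-- Markov's principle is an instance of EM₁⁻ with C := P^⊥: under ¬∀αP the
-- branch ∀αP is absurd and the branch ∃αP^⊥ is the conclusion itself.
-- Conversely, MRK makes atomic existentials ¬¬-stable (apply MRK to C^⊥ and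
-- use C^⊥⊥ = C), so it suffices to derive ¬¬∃αC from the two premises of
-- EM₁⁻: given ¬∃αC, the first premise yields ¬∀αP, MRK yields ∃αP^⊥, and
-- the second premise yields ∃αC.
module Submission where

open import Defs
open import Data.Nat using (ℕ; suc)
open import Data.Fin using (Fin; zero; suc)
open import Data.Vec using (Vec; []; _∷_)
open import Data.Bool using (true; false)
open import Data.List using (List; []; _∷_; map)
open import Data.List.Membership.Propositional using (_∈_)
open import Data.List.Membership.Propositional.Properties using (∈-map⁺)
open import Data.List.Relation.Unary.Any using (here; there)
open import Data.List.Relation.Unary.All using (All; []; _∷_)
open import Data.Product using (_×_; _,_)
import Data.Empty as Empty
open import Relation.Binary.PropositionalEquality using (_≡_; refl; cong; cong₂; subst)

ᶜ-involutive : ∀ {n} (a : Atom n) → a ᶜ ᶜ ≡ a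
ᶜ-involutive (rel true  f ts) = refl
ᶜ-involutive (rel false f ts) = refl

complement-unsatisfiable : ∀ {n} (a : Atom n) (ρ : Fin n → ℕ) →
                           All (λ x → ⟦ x ⟧ₐ ρ) (a ∷ a ᶜ ∷ []) → Empty.⊥
complement-unsatisfiable (rel true  f ts) ρ (p ∷ q ∷ []) = q p
complement-unsatisfiable (rel false f ts) ρ (p ∷ q ∷ []) = p q

mutual
  subT-inverseˡ : ∀ {n m} (σ : Fin n → Term m) (τ : Fin m → Term n) →
                  (∀ i → subT τ (σ i) ≡ var i) → ∀ t → subT τ (subT σ t) ≡ t
  subT-inverseˡ σ τ inv (var i)    = inv i
  subT-inverseˡ σ τ inv (app f ts) = cong (app f) (subTs-inverseˡ σ τ inv ts)

  subTs-inverseˡ : ∀ {n m k} (σ : Fin n → Term m) (τ : Fin m → Term n) →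
                   (∀ i → subT τ (σ i) ≡ var i) →
                   (ts : Vec (Term n) k) → subTs τ (subTs σ ts) ≡ ts
  subTs-inverseˡ σ τ inv []       = refl
  subTs-inverseˡ σ τ inv (t ∷ ts) = cong₂ _∷_ (subT-inverseˡ σ τ inv t) (subTs-inverseˡ σ τ inv ts)

wkF-∀-instance-var₀ : ∀ {n} (a : Atom (suc n)) →
                      subF (liftσ (λ i → var (suc i))) (atom a) [ var zero ] ≡ atom a
wkF-∀-instance-var₀ (rel b f ts) =
  cong (λ us → atom (rel b f us))
       (subTs-inverseˡ (liftσ (λ i → var (suc i))) _ (λ { zero → refl ; (suc i) → refl }) ts)

∃-refuted-by-∀ᶜ : ∀ {n s} {Γ : List (Formula n)} (a : Atom (suc n)) →
                  ∀' (atom (a ᶜ)) ∈ Γ → Γ ⊢[ s ] ∃' (atom a) → Γ ⊢[ s ] ⊥'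
∃-refuted-by-∀ᶜ {s = s} {Γ} a ∀aᶜ∈Γ ∃a =
  ∃E ∃a (post⊥ (a ∷ a ᶜ ∷ []) (complement-unsatisfiable a) (ax (here refl) ∷ aᶜ ∷ []))
  where
  aᶜ : (atom a ∷ map wkF Γ) ⊢[ s ] atom (a ᶜ)
  aᶜ = subst ((atom a ∷ map wkF Γ) ⊢[ s ]_) (wkF-∀-instance-var₀ (a ᶜ))
             (∀E (ax (there (∈-map⁺ wkF ∀aᶜ∈Γ))) (var zero))

markov-by-em1⁻ : ∀ {n} {Γ : List (Formula n)} (P : Atom (suc n)) →
                 Γ ⊢[ HA+EM1⁻ ] ¬' (∀' (atom P)) ⇒ ∃' (atom (P ᶜ))
markov-by-em1⁻ P =
  ⇒I (em1⁻ P (P ᶜ) (⊥E (⇒E (ax (there (here refl))) (ax (here refl)))) (ax (here refl)))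

¬¬∃-stable-by-mrk : ∀ {n} {Γ : List (Formula n)} (C : Atom (suc n)) →
                    Γ ⊢[ HA+MRK ] ¬' (¬' (∃' (atom C))) ⇒ ∃' (atom C)
¬¬∃-stable-by-mrk {Γ = Γ} C = ⇒I (subst (λ D → ¬¬∃C ∷ Γ ⊢[ HA+MRK ] ∃' (atom D))
                                        (ᶜ-involutive C)
                                        (⇒E (mrk (C ᶜ)) ¬∀Cᶜ))
  where
  ¬¬∃C : Formula _
  ¬¬∃C = ¬' (¬' (∃' (atom C)))
  ¬∀Cᶜ : ¬¬∃C ∷ Γ ⊢[ HA+MRK ] ¬' (∀' (atom (C ᶜ)))
  ¬∀Cᶜ = ⇒I (⇒E (ax (there (here refl)))
                (⇒I (∃-refuted-by-∀ᶜ C (there (here refl)) (ax (here refl)))))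

em1⁻-premises⇒¬¬∃ : ∀ {n} {Γ : List (Formula n)} (P C : Atom (suc n)) →
                     Γ ⊢[ HA+MRK ] (∀' (atom P) ⇒ ∃' (atom C)) ⇒
                                   (∃' (atom (P ᶜ)) ⇒ ∃' (atom C)) ⇒ ¬' (¬' (∃' (atom C)))
em1⁻-premises⇒¬¬∃ {Γ = Γ} P C = ⇒I (⇒I (⇒I (⇒E (ax ¬∃C) (⇒E (ax ∃Pᶜ⇒∃C) (⇒E (mrk P) ¬∀P)))))
  where
  Δ : List (Formula _)
  Δ = ¬' (∃' (atom C)) ∷ (∃' (atom (P ᶜ)) ⇒ ∃' (atom C)) ∷ (∀' (atom P) ⇒ ∃' (atom C)) ∷ Γ
  ¬∃C : ¬' (∃' (atom C)) ∈ Δ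
  ¬∃C = here refl
  ∃Pᶜ⇒∃C : (∃' (atom (P ᶜ)) ⇒ ∃' (atom C)) ∈ Δ
  ∃Pᶜ⇒∃C = there (here refl)
  ∀P⇒∃C : (∀' (atom P) ⇒ ∃' (atom C)) ∈ Δ
  ∀P⇒∃C = there (there (here refl))
  ¬∀P : Δ ⊢[ HA+MRK ] ¬' (∀' (atom P))
  ¬∀P = ⇒I (⇒E (ax (there ¬∃C)) (⇒E (ax (there ∀P⇒∃C)) (ax (here refl))))

em1⁻-by-mrk : ∀ {n} (Γ : List (Formula n)) (P C : Atom (suc n)) →
              (∀' (atom P) ∷ Γ) ⊢[ HA+MRK ] ∃' (atom C) →
              (∃' (atom (P ᶜ)) ∷ Γ) ⊢[ HA+MRK ] ∃' (atom C) →
              Γ ⊢[ HA+MRK ] ∃' (atom C)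
em1⁻-by-mrk Γ P C ∀P⊢∃C ∃Pᶜ⊢∃C =
  ⇒E (¬¬∃-stable-by-mrk C) (⇒E (⇒E (em1⁻-premises⇒¬¬∃ P C) (⇒I ∀P⊢∃C)) (⇒I ∃Pᶜ⊢∃C))

mainTheorem6 :
    (∀ {n} (P : Atom (suc n)) →
       [] ⊢[ HA+EM1⁻ ] ¬' (∀' (atom P)) ⇒ ∃' (atom (P ᶜ)))
    ×
    (∀ {n} (Γ : List (Formula n)) (P C : Atom (suc n)) →
       (∀' (atom P) ∷ Γ) ⊢[ HA+MRK ] ∃' (atom C) →
       (∃' (atom (P ᶜ)) ∷ Γ) ⊢[ HA+MRK ] ∃' (atom C) →
       Γ ⊢[ HA+MRK ] ∃' (atom C))
mainTheorem6 = markov-by-em1⁻ , em1⁻-by-mrk
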